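{- Let $A$ be a (possibly infinite) alphabet and let $<$ be the generalized lexicographic order induced by a sequence $(<_n)_{n\in\mathbb{N}}$ of total orders on $A$. Let $w$ be an infinite word over $A$ that has a (not necessarily proper) suffix which is an infinite generalized Lyndon word. Then $w$ has a unique nonincreasing factorization into generalized Lyndon words, and this factorization has finitely many terms. Furthermore, the last term of this factorization is the first generalized Lyndon suffix of $w$ by index, i.e. the suffix $w[j,\infty)$ of $w$ with $j\in\mathbb{N}$ minimal such that $w[j,\infty)$ is an infinite generalized Lyndon word.
   Context: $\mathbb{N}=\{1,2,3,\dots\}$. Words are finite or infinite (to the right) sequences of letters of $A$. For an infinite word $w$, $w[j,\infty)$ denotes the suffix of $w$ beginning at its $j$-th letter. For each $n\in\mathbb{N}$ let $<_n$ be a total order on $A$. The generalized lexicographic order $<$ induced by $(<_n)_{n\in\mathbb{N}}$ on finite and infinite words is: $x<y$ if and only if $x$ is a proper prefix of $y$, or $x=pas$ and $y=pbs'$ for words $p,s,s'$ ($p$ finite) and letters $a,b$ with $a<_{|p|+1}b$. For a nonempty finite word $u$, $u^\omega$ is the infinite word $uuu\cdots$; if $u$ is infinite, $u^\omega=u$ by convention. A nonempty finite word $w$ is generalized Lyndon if $uv<vu$ for every factorization $w=uv$ with $u,v$ both nonempty. An infinite word $w$ is generalized Lyndon if $w<v$ for every factorization $w=uv$ with $u$ a nonempty finite word. A nonincreasing generalized Lyndon factorization of a word $w$ is a product $w=\prod_{i=1}^n\ell_i$ with $n\in\mathbb{N}\cup\{\infty\}$, each $\ell_i$ generalized Lyndon,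 and $\ell_i^\omega\ge\ell_{i+1}^\omega$ for all $i\in[1,n)$; only the last factor of a factorization with finitely many terms may be an infinite word. -}

module Defs where

open import Data.List.Base using (List; []; _∷_; _++_; _∷ʳ_; length; lookup; concat; map; applyUpTo)
open import Data.List.Relation.Unary.All using (All)
open import Data.List.Relation.Unary.Linked using (Linked)
open import Data.Nat.Base using (ℕ; zero; suc; _+_; _≤_)
open import Data.Nat.DivMod using (_mod_)
open import Data.Product.Base using (∃; _×_)
open import Data.Sum.Base using (_⊎_)
open import Function.Bundles using (_⇔_)
open import Level using (_⊔_)
open import Relation.Binary.Core using (Rel)
open import Relation.Binary.PropositionalEquality using (_≡_; _≢_; _≗_)

-- Positions, suffix indices and the indices of the letter orders all start
-- at 0 here, where the usual convention for words starts at 1.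

data Word {a} (A : Set a) : Set a where
  fin : List A → Word A
  inf : (ℕ → A) → Word A

module _ {a} {A : Set a} where

  infix  4 _≈_ _≼_
  infixr 5 _·_ _·∞_
  infix  8 _^ω
  infix  9 _[_,∞⟩

  -- Infinite words are functions, so they are compared pointwise.
  data _≈_ : Rel (Word A) a where
    fin : ∀ {u v} → u ≡ v → fin u ≈ fin v
    inf : ∀ {x y} → x ≗ y → inf x ≈ inf y

  _·∞_ : List A → (ℕ → A) → (ℕ → A)
  ([]      ·∞ x) k       = x k
  ((c ∷ u) ·∞ x) zero    = c
  ((c ∷ u) ·∞ x) (suc k) = (u ·∞ x) k

  _·_ : List A → Word A → Word A
  u · fin v = fin (u ++ v)
  u · inf x = inf (u ·∞ x)

  _[_,∞⟩ : (ℕ → A) → ℕ → (ℕ → A)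
  (w [ j ,∞⟩) k = w (j + k)

  _≼_ : List A → Word A → Set a
  p ≼ w = ∃ λ s → w ≈ p · s

  -- Only used for nonempty words; the value at the empty word is arbitrary.
  _^ω : Word A → Word A
  fin []      ^ω = fin []
  fin (c ∷ u) ^ω = inf λ k → lookup (c ∷ u) (k mod suc (length u))
  inf x       ^ω = inf x

-- Sequences of n factors, n ∈ {1, 2, …} ∪ {∞}, in which only the last factor
-- of a sequence with finitely many terms may be an infinite word.
data Factors {a} (A : Set a) : Set a where
  finitely   : List (List A) → Word A → Factors A
  infinitely : (ℕ → List A) → Factors A

module _ {a} {A : Set a} where

  infix 4 _≈ᶠ_ _IsProductOf_

  data _≈ᶠ_ : Rel (Factors A) a where
    finitely   : ∀ {us vs x y} → us ≡ vs → x ≈ y → finitely us x ≈ᶠ finitely vs y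
    infinitely : ∀ {f g} → f ≗ g → infinitely f ≈ᶠ infinitely g

  -- A word is determined by its set of finite prefixes; an infinite product
  -- is the word whose finite prefixes are those of the partial products.
  _IsProductOf_ : Word A → Factors A → Set a
  w IsProductOf finitely us x = w ≈ concat us · x
  w IsProductOf infinitely f  =
    ∀ p → p ≼ w ⇔ ∃ λ n → p ≼ fin (concat (applyUpTo f n))

module GeneralizedLexicographic {a r} {A : Set a} (_≺[_]_ : A → ℕ → A → Set r) where

  infix 4 _<_ _≥_

  -- Since indices start at 0, the letters following a common prefix p are
  -- compared with the order of index |p|.
  data _<_ (x y : Word A) : Set (a ⊔ r) where
    proper-prefix : ∀ p c s → x ≈ fin p → y ≈ (p ∷ʳ c) · s → x < y
    differ        : ∀ p c d s t → c ≺[ length p ] d →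
                    x ≈ (p ∷ʳ c) · s → y ≈ (p ∷ʳ d) · t → x < y

  _≥_ : Rel (Word A) (a ⊔ r)
  x ≥ y = y < x ⊎ y ≈ x

  Lyndon : Word A → Set (a ⊔ r)
  Lyndon (fin w) = w ≢ [] ×
    (∀ u v → u ≢ [] → v ≢ [] → w ≡ u ++ v → fin (u ++ v) < fin (v ++ u))
  Lyndon (inf w) = ∀ u v → u ≢ [] → inf w ≈ u · inf v → inf w < inf v

  AllLyndon : Factors A → Set (a ⊔ r)
  AllLyndon (finitely us x) = All Lyndon (map fin us ∷ʳ x)
  AllLyndon (infinitely f)  = ∀ i → Lyndon (fin (f i))

  Nonincreasing : Factors A → Set (a ⊔ r)
  Nonincreasing (finitely us x) = Linked (λ u v → u ^ω ≥ v ^ω) (map fin us ∷ʳ x)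
  Nonincreasing (infinitely f)  = ∀ i → fin (f i) ^ω ≥ fin (f (suc i)) ^ω

  IsNonincreasingLyndonFactorization : Word A → Factors A → Set (a ⊔ r)
  IsNonincreasingLyndonFactorization w F =
    w IsProductOf F × AllLyndon F × Nonincreasing F

  IsFirstLyndonSuffixIndex : (ℕ → A) → ℕ → Set (a ⊔ r)
  IsFirstLyndonSuffixIndex w j =
    Lyndon (inf (w [ j ,∞⟩)) × (∀ i → Lyndon (inf (w [ i ,∞⟩)) → j ≤ i)

{-# OPTIONS --safe #-}
-- For a nonempty word u, comparing u·x with x is the same as comparing u^ω
-- with x.  Hence tu has a smaller ω-power than u exactly when t has, and w is
-- Lyndon exactly when w^ω < v^ω for every proper suffix v.
--
-- In a nonincreasing Lyndon sequence ℓ₁ … ℓₙ every nonempty suffix s of the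
-- product satisfies s^ω ≥ ℓₙ^ω, so ℓₙ is the shortest suffix with minimal
-- ω-power.  This gives existence and uniqueness of factorizations of finite
-- words.  If moreover ℓₙ^ω ≥ x with x infinite Lyndon, then sx ≥ x is not
-- Lyndon, so x is the first Lyndon suffix of ℓ₁ … ℓₙ x; conversely, if x is the
-- first Lyndon suffix of px then sx ≥ x for every suffix s of p, since a
-- shortest counterexample sx would be Lyndon.
--
-- Let w = ℓ₁ℓ₂ … be an infinite nonincreasing product with rests
-- yₙ = ℓₙ₊₁ℓₙ₊₂ ….  If w had a Lyndon suffix, then syₙ < yₙ for some suffix s
-- (depending on n) of ℓ₁ … ℓₙ, for all large n, so ℓₙ^ω ≤ s^ω < yₙ; the
-- positions where ℓₙ^ω and yₙ first differ would then decrease forever.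

module Submission where

open import Axiom.ExcludedMiddle using (ExcludedMiddle)
open import Data.Empty using (⊥-elim)
open import Data.Fin.Base using (fromℕ<)
open import Data.Fin.Properties using (fromℕ<-cong)
open import Data.List.Base
  using (List; []; _∷_; _++_; _∷ʳ_; [_]; length; lookup; concat; map; applyUpTo; take; drop)
open import Data.List.Properties
  using (length-++; length-++-comm; length-applyUpTo; applyUpTo-∷ʳ; concat-++; map-++; ++-assoc;
         ++-identityʳ; ∷-injective; ∷-injectiveʳ; ++-conicalʳ; take++drop≡id)
open import Data.List.Relation.Unary.All using (All; []; _∷_)
open import Data.List.Relation.Unary.All.Properties using (∷ʳ⁺; ∷ʳ⁻)
open import Data.List.Relation.Unary.Linked using (Linked; []; [-]; _∷_)
open import Data.List.Reverse using (Reverse; []; _∶_∶ʳ_; reverseView)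
open import Data.Nat.Base
  using (ℕ; zero; suc; _+_; _∸_; _≤_; z≤n; s≤s; s<s; z<s) renaming (_<_ to _<ℕ_)
open import Data.Nat.DivMod using (_%_; _mod_; m<n⇒m%n≡m; [m+n]%n≡m%n; m%n<n)
open import Data.Nat.Induction using (<-rec)
open import Data.Nat.Properties
  using (≤-refl; ≤-trans; ≤-reflexive; ≤-antisym; <⇒≤; <-cmp; <-≤-trans; m≤n⇒m<n∨m≡n; ≰⇒>; ≮⇒≥;
         _<?_; +-comm; +-monoˡ-≤; +-mono-≤; m≤m+n; n<1+n; m<n⇒m<1+n; m+[n∸m]≡n; m<m+n; m<n+m;
         m≤n⇒m≤1+n; <⇒≱; ≤-pred; <⇒≢)
open import Data.Product using (∃; ∃₂; ∃!; _×_; _,_; proj₁; proj₂)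
open import Data.Sum using (_⊎_; inj₁; inj₂)
open import Function.Base using (_∘_; case_of_)
open import Function.Bundles using (Equivalence)
open import Level using (_⊔_; Lift; lift; lower)
open import Relation.Binary.Definitions using (tri<; tri≈; tri>)
open import Relation.Binary.PropositionalEquality
  using (_≡_; _≢_; _≗_; refl; sym; trans; cong; cong₂; subst; subst₂)
open import Relation.Binary.Structures using (IsStrictTotalOrder)
open import Relation.Nullary using (¬_; Dec; yes; no; contradiction)
open import Relation.Nullary.Decidable using (map′; ¬?; decidable-stable)
open import Relation.Unary using (Decidable)
open import Defs

-- Pointwise equality and least witnesses.

≗-sym : ∀ {a} {A : Set a} {x y : ℕ → A} → x ≗ y → y ≗ x
≗-sym p i = sym (p i)

≗-trans : ∀ {a} {A : Set a} {x y z : ℕ → A} → x ≗ y → y ≗ z → x ≗ z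
≗-trans p q i = trans (p i) (q i)

least : ∀ {p} {P : ℕ → Set p} → Decidable P → ∃ P → ∃ λ n → P n × (∀ i → i <ℕ n → ¬ P i)
least {P = P} P? (n , pn) = <-rec (λ n → P n → ∃ λ m → P m × (∀ i → i <ℕ m → ¬ P i)) step n pn
  where
  below : ∀ n → (∃ λ i → i <ℕ n × P i) ⊎ (∀ i → i <ℕ n → ¬ P i)
  below zero = inj₂ λ _ ()
  below (suc n) with below n
  ... | inj₁ (i , i<n , pi) = inj₁ (i , m<n⇒m<1+n i<n , pi)
  ... | inj₂ none with P? n
  ...   | yes pn = inj₁ (n , n<1+n n , pn)
  ...   | no ¬pn = inj₂ λ { i (s≤s i≤n) → case m≤n⇒m<n∨m≡n i≤n of
            λ { (inj₁ i<n) → none i i<n ; (inj₂ refl) → ¬pn } }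
  step : ∀ n → (∀ {m} → m <ℕ n → P m → ∃ λ k → P k × (∀ i → i <ℕ k → ¬ P i)) →
         P n → ∃ λ k → P k × (∀ i → i <ℕ k → ¬ P i)
  step n rec pn with below n
  ... | inj₁ (m , m<n , pm) = rec m<n pm
  ... | inj₂ none           = n , pn , none

-- Concatenation, prefixes and suffixes of words.

module _ {a} {A : Set a} where

  ++-align : ∀ (u v s t : List A) → u ++ v ≡ s ++ t →
             (∃ λ r → u ≡ s ++ r × t ≡ r ++ v) ⊎ (∃ λ r → s ≡ u ++ r × v ≡ r ++ t)
  ++-align u       v []      t eq = inj₁ (u , refl , sym eq)
  ++-align []      v (d ∷ s) t eq = inj₂ (d ∷ s , refl , eq)
  ++-align (c ∷ u) v (d ∷ s) t eq with ∷-injective eq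
  ... | refl , eq′ with ++-align u v s t eq′
  ...   | inj₁ (r , p , q) = inj₁ (r , cong (c ∷_) p , q)
  ...   | inj₂ (r , p , q) = inj₂ (r , cong (c ∷_) p , q)

  ++-≢[]ʳ : ∀ (u : List A) {v} → v ≢ [] → u ++ v ≢ []
  ++-≢[]ʳ u v≢[] eq = v≢[] (++-conicalʳ u _ eq)

  ++-≢[]ˡ : ∀ {u} (v : List A) → u ≢ [] → u ++ v ≢ []
  ++-≢[]ˡ {[]}    v u≢[] = contradiction refl u≢[]
  ++-≢[]ˡ {_ ∷ _} v u≢[] ()

  0<length : ∀ {u : List A} → u ≢ [] → 0 <ℕ length u
  0<length {[]}    u≢[] = contradiction refl u≢[]
  0<length {_ ∷ _} u≢[] = z<s

  concat-∷ʳ : ∀ (us : List (List A)) u → concat (us ∷ʳ u) ≡ concat us ++ u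
  concat-∷ʳ us u = trans (sym (concat-++ us [ u ])) (cong (concat us ++_) (++-identityʳ u))

  ·∞-cong : ∀ u {x y : ℕ → A} → x ≗ y → u ·∞ x ≗ u ·∞ y
  ·∞-cong []      x≗y k       = x≗y k
  ·∞-cong (c ∷ u) x≗y zero    = refl
  ·∞-cong (c ∷ u) x≗y (suc k) = ·∞-cong u x≗y k

  ·∞-++ : ∀ u v (x : ℕ → A) → (u ++ v) ·∞ x ≗ u ·∞ (v ·∞ x)
  ·∞-++ []      v x k       = refl
  ·∞-++ (c ∷ u) v x zero    = refl
  ·∞-++ (c ∷ u) v x (suc k) = ·∞-++ u v x k

  ·∞-shift : ∀ u (x : ℕ → A) → (u ·∞ x) [ length u ,∞⟩ ≗ x
  ·∞-shift []      x k = refl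
  ·∞-shift (c ∷ u) x k = ·∞-shift u x k

  ·∞-lookup : ∀ u (x : ℕ → A) {k} (k<u : k <ℕ length u) → (u ·∞ x) k ≡ lookup u (fromℕ< k<u)
  ·∞-lookup (c ∷ u) x {zero}  k<u       = refl
  ·∞-lookup (c ∷ u) x {suc k} (s≤s k<u) = ·∞-lookup u x k<u

  applyUpTo-·∞ : ∀ (x : ℕ → A) n → x ≗ applyUpTo x n ·∞ x [ n ,∞⟩
  applyUpTo-·∞ x zero    k       = refl
  applyUpTo-·∞ x (suc n) zero    = refl
  applyUpTo-·∞ x (suc n) (suc k) = applyUpTo-·∞ (x ∘ suc) n k

  infix 4 _≈[_]_

  _≈[_]_ : (ℕ → A) → ℕ → (ℕ → A) → Set a
  x ≈[ k ] y = ∀ i → i <ℕ k → x i ≡ y i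

  ·∞-agree : ∀ u (x y : ℕ → A) → (u ·∞ x) ≈[ length u ] (u ·∞ y)
  ·∞-agree (c ∷ u) x y zero    _         = refl
  ·∞-agree (c ∷ u) x y (suc i) (s≤s i<u) = ·∞-agree u x y i i<u

  ·∞-agree-+ : ∀ u {x y : ℕ → A} {k} → x ≈[ k ] y → (u ·∞ x) ≈[ length u + k ] (u ·∞ y)
  ·∞-agree-+ []      x≈y i       i<k       = x≈y i i<k
  ·∞-agree-+ (c ∷ u) x≈y zero    _         = refl
  ·∞-agree-+ (c ∷ u) x≈y (suc i) (s≤s i<k) = ·∞-agree-+ u x≈y i i<k

  ·∞-align : ∀ u v {x y : ℕ → A} → u ·∞ x ≗ v ·∞ y →
             (∃ λ t → u ≡ v ++ t × y ≗ t ·∞ x) ⊎ (∃ λ t → v ≡ u ++ t × x ≗ t ·∞ y)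
  ·∞-align u       []      eq = inj₁ (u , refl , ≗-sym eq)
  ·∞-align []      (d ∷ v) eq = inj₂ (d ∷ v , refl , eq)
  ·∞-align (c ∷ u) (d ∷ v) eq with eq 0 | ·∞-align u v (λ k → eq (suc k))
  ... | refl | inj₁ (t , p , q) = inj₁ (t , cong (c ∷_) p , q)
  ... | refl | inj₂ (t , p , q) = inj₂ (t , cong (c ∷_) p , q)

  applyUpTo-cong : ∀ {x y : ℕ → A} n → x ≈[ n ] y → applyUpTo x n ≡ applyUpTo y n
  applyUpTo-cong zero    x≈y = refl
  applyUpTo-cong (suc n) x≈y =
    cong₂ _∷_ (x≈y 0 z<s) (applyUpTo-cong n (λ i i<n → x≈y (suc i) (s<s i<n)))

  applyUpTo-length : ∀ u (x : ℕ → A) → applyUpTo (u ·∞ x) (length u) ≡ u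
  applyUpTo-length []      x = refl
  applyUpTo-length (c ∷ u) x = cong (c ∷_) (applyUpTo-length u x)

  take-applyUpTo : ∀ u (x : ℕ → A) {n} → n ≤ length u → take n u ≡ applyUpTo (u ·∞ x) n
  take-applyUpTo u       x {zero}  n≤u       = refl
  take-applyUpTo (c ∷ u) x {suc n} (s≤s n≤u) = cong (c ∷_) (take-applyUpTo u x n≤u)

  prefix-unique : ∀ {w x y : ℕ → A} u v → w ≗ u ·∞ x → w ≗ v ·∞ y → length u ≡ length v → u ≡ v
  prefix-unique {w} {x} {y} u v p q eq = trans (sym (applyUpTo-length u x))
    (trans (applyUpTo-cong (length u) λ i _ → trans (sym (p i)) (q i))
    (trans (cong (applyUpTo (v ·∞ y)) eq) (applyUpTo-length v y)))

  suffix-of-prefix : ∀ {w x : ℕ → A} u v → w ≗ (u ++ v) ·∞ x → w [ length u ,∞⟩ ≗ v ·∞ x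
  suffix-of-prefix {w} {x} u v p k =
    trans (p (length u + k)) (trans (·∞-++ u v x _) (·∞-shift u (v ·∞ x) k))

  suffix-at : ∀ {w x : ℕ → A} u → w ≗ u ·∞ x → w [ length u ,∞⟩ ≗ x
  suffix-at {w} {x} u p k = trans (p (length u + k)) (·∞-shift u x k)

  split-at< : ∀ (u : List A) {k} → k <ℕ length u → ∃₂ λ v s → u ≡ v ++ s × length v ≡ k × s ≢ []
  split-at< (c ∷ u) {zero}  _         = [] , c ∷ u , refl , refl , λ ()
  split-at< (c ∷ u) {suc k} (s≤s k<u) with split-at< u k<u
  ... | v , s , eq , len , s≢[] = c ∷ v , s , cong (c ∷_) eq , cong suc len , s≢[]

  Linked-∷ʳ⁻ : ∀ {r} {R : A → A → Set r} us {u v} →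
               Linked R ((us ∷ʳ u) ∷ʳ v) → Linked R (us ∷ʳ u) × R u v
  Linked-∷ʳ⁻ []           (Ruv ∷ _)  = [-] , Ruv
  Linked-∷ʳ⁻ (_ ∷ [])     (R₁ ∷ Rs) with Linked-∷ʳ⁻ [] Rs
  ... | Rs′ , Ruv = R₁ ∷ Rs′ , Ruv
  Linked-∷ʳ⁻ (_ ∷ us@(_ ∷ _)) (R₁ ∷ Rs) with Linked-∷ʳ⁻ us Rs
  ... | Rs′ , Ruv = R₁ ∷ Rs′ , Ruv

  Linked-∷ʳ⁺ : ∀ {r} {R : A → A → Set r} us {u v} →
               Linked R (us ∷ʳ u) → R u v → Linked R ((us ∷ʳ u) ∷ʳ v)
  Linked-∷ʳ⁺ []               _         Ruv = Ruv ∷ [-]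
  Linked-∷ʳ⁺ (_ ∷ [])         (R₁ ∷ _)  Ruv = R₁ ∷ Ruv ∷ [-]
  Linked-∷ʳ⁺ (_ ∷ us@(_ ∷ _)) (R₁ ∷ Rs) Ruv = R₁ ∷ Linked-∷ʳ⁺ us Rs Ruv

-- Periodic infinite words.

module Powers {a} {A : Set a} (o : A) where

  infix 8 _^∞

  -- The junk value at [] makes ^∞-unfold hold for every list.
  _^∞ : List A → ℕ → A
  []        ^∞ = λ _ → o
  u@(_ ∷ _) ^∞ = λ k → lookup u (k mod length u)

  fin-^ω : ∀ {u} → u ≢ [] → fin u ^ω ≡ inf (u ^∞)
  fin-^ω {[]}    u≢[] = contradiction refl u≢[]
  fin-^ω {_ ∷ _} u≢[] = refl

  ^∞-unfold : ∀ u → u ^∞ ≗ u ·∞ (u ^∞)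
  ^∞-unfold []        k = refl
  ^∞-unfold u@(_ ∷ _) k with k <? length u
  ... | yes k<n = trans
        (cong (lookup u) (fromℕ<-cong _ _ (m<n⇒m%n≡m k<n) (m%n<n k _) k<n))
        (sym (·∞-lookup u (u ^∞) k<n))
  -- Write k as |u| + i: the remainder modulo |u| is that of i.
  ... | no k≮n = subst (λ k → (u ^∞) k ≡ (u ·∞ (u ^∞)) k) (m+[n∸m]≡n (≮⇒≥ k≮n)) (trans
        (cong (lookup u) (fromℕ<-cong _ _
          (trans (cong (_% length u) (+-comm (length u) i)) ([m+n]%n≡m%n i (length u)))
          (m%n<n (length u + i) _) (m%n<n i _)))
        (sym (·∞-shift u (u ^∞) i)))
        where i = k ∸ length u

  -- By `^∞-unfold`, prepending u lengthens the agreement by |u| ≥ 1 letters.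
  ^∞-next : ∀ {u x k} → u ≢ [] → x ≈[ k ] u ^∞ → (u ·∞ x) ≈[ suc k ] u ^∞
  ^∞-next {u} {x} {k} u≢[] x≈u i i≤k = trans
    (·∞-agree-+ u x≈u i (<-≤-trans i≤k (+-monoˡ-≤ k (0<length u≢[]))))
    (sym (^∞-unfold u i))

  -- Induction on k: if x agrees with u^ω on k letters, then ux does on k+1, and x shares these
  -- letters with ux.
  ^∞-periodic : ∀ {u x k} → u ≢ [] → x ≈[ k ] (u ·∞ x) → x ≈[ k ] u ^∞
  ^∞-periodic {k = suc k} u≢[] x≈ux i i≤k = trans (x≈ux i i≤k)
    (^∞-next u≢[] (^∞-periodic u≢[] λ j j<k → x≈ux j (m<n⇒m<1+n j<k)) i i≤k)

  ^∞-unique : ∀ {u x} → u ≢ [] → x ≗ u ·∞ x → x ≗ u ^∞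
  ^∞-unique u≢[] x≗ux i = ^∞-periodic u≢[] (λ j _ → x≗ux j) i (n<1+n i)

  -- Prepending uv to the left side gives it back, and `^∞-unique` allows only one such word.
  ^∞-rotate : ∀ {u v} → v ++ u ≢ [] → u ·∞ ((v ++ u) ^∞) ≗ (u ++ v) ^∞
  ^∞-rotate {u} {v} vu≢[] = ^∞-unique (λ eq → vu≢[] (rotate-[] u eq)) λ i → trans
    (·∞-cong u (≗-trans (^∞-unfold (v ++ u)) (·∞-++ v u _)) i)
    (sym (·∞-++ u v _ i))
    where
    rotate-[] : ∀ u {v : List A} → u ++ v ≡ [] → v ++ u ≡ []
    rotate-[] [] refl = refl


-- The order on infinite words.

module _ {a r} (em : ExcludedMiddle (a ⊔ r)) {A : Set a} (_≺[_]_ : A → ℕ → A → Set r)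
         (isSTO : ∀ n → IsStrictTotalOrder _≡_ (λ c d → c ≺[ n ] d)) (o : A) where

  open GeneralizedLexicographic _≺[_]_
  open Powers o
  private module STO n = IsStrictTotalOrder (isSTO n)

  infix 4 _<[_]_ _<∞_ _≲_

  -- The position of the first difference is recorded because the descent for infinite products runs
  -- on it.
  _<[_]_ : (ℕ → A) → ℕ → (ℕ → A) → Set (a ⊔ r)
  x <[ k ] y = x ≈[ k ] y × x k ≺[ k ] y k

  _<∞_ : (ℕ → A) → (ℕ → A) → Set (a ⊔ r)
  x <∞ y = ∃ λ k → x <[ k ] y

  -- The negative form is what arguments by contradiction yield; `≲⇒<∨≗` recovers the two cases
  -- classically.
  _≲_ : (ℕ → A) → (ℕ → A) → Set (a ⊔ r)
  x ≲ y = ¬ y <∞ x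

  ≺-irrefl : ∀ {n c d} → c ≡ d → ¬ c ≺[ n ] d
  ≺-irrefl {n} = STO.irrefl n

  <[]-resp : ∀ {x x′ y y′ k} → x ≗ x′ → y ≗ y′ → x <[ k ] y → x′ <[ k ] y′
  <[]-resp {k = k} x≗x′ y≗y′ (x≈y , xk≺yk) =
    (λ i i<k → trans (sym (x≗x′ i)) (trans (x≈y i i<k) (y≗y′ i))) ,
    subst₂ (λ c d → c ≺[ k ] d) (x≗x′ k) (y≗y′ k) xk≺yk

  <∞-resp : ∀ {x x′ y y′} → x ≗ x′ → y ≗ y′ → x <∞ y → x′ <∞ y′
  <∞-resp x≗x′ y≗y′ (k , x<y) = k , <[]-resp x≗x′ y≗y′ x<y

  ≲-resp : ∀ {x x′ y y′} → x ≗ x′ → y ≗ y′ → x ≲ y → x′ ≲ y′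
  ≲-resp x≗x′ y≗y′ x≲y y′<x′ = x≲y (<∞-resp (≗-sym y≗y′) (≗-sym x≗x′) y′<x′)

  <∞-irrefl : ∀ {x y} → x ≗ y → ¬ x <∞ y
  <∞-irrefl x≗y (k , _ , xk≺yk) = ≺-irrefl (x≗y k) xk≺yk

  -- The first difference of x and z is at the smaller of k and l. The descent needs the bound by l.
  <[]-trans : ∀ {x y z k l} → x <[ k ] y → y <[ l ] z → ∃ λ m → m ≤ l × x <[ m ] z
  <[]-trans {x} {y} {z} {k} {l} (x≈y , xk≺yk) (y≈z , yl≺zl) with <-cmp k l
  ... | tri< k<l _ _ = k , <⇒≤ k<l ,
        (λ i i<k → trans (x≈y i i<k) (y≈z i (<-≤-trans i<k (<⇒≤ k<l)))) ,
        subst (λ d → x k ≺[ k ] d) (y≈z k k<l) xk≺yk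
  ... | tri≈ _ refl _ = k , ≤-refl ,
        (λ i i<k → trans (x≈y i i<k) (y≈z i i<k)) , STO.trans k xk≺yk yl≺zl
  ... | tri> _ _ l<k = l , ≤-refl ,
        (λ i i<l → trans (x≈y i (<-≤-trans i<l (<⇒≤ l<k))) (y≈z i i<l)) ,
        subst (λ c → c ≺[ l ] z l) (sym (x≈y l l<k)) yl≺zl

  <∞-trans : ∀ {x y z} → x <∞ y → y <∞ z → x <∞ z
  <∞-trans (_ , x<y) (_ , y<z) with <[]-trans x<y y<z
  ... | m , _ , x<z = m , x<z

  em-lift : (P : Set a) → Dec P
  em-lift P = map′ lower lift (em {Lift r P})

  -- Unless the words agree everywhere, they have a least position of disagreement, and trichotomy
  -- of the order of that index decides.
  ≲⇒<∨≗ : ∀ {x y} → x ≲ y → x <∞ y ⊎ x ≗ y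
  ≲⇒<∨≗ {x} {y} x≲y with em-lift (∃ λ k → x k ≢ y k)
  ... | no agree = inj₂ λ k → decidable-stable (STO._≟_ 0 (x k) (y k)) λ xk≢yk → agree (k , xk≢yk)
  ... | yes distinct with least (λ k → ¬? (STO._≟_ 0 (x k) (y k))) distinct
  ...   | k , xk≢yk , below = case STO.compare k (x k) (y k) of λ
            { (tri< xk≺yk _ _) → inj₁ (k , agree , xk≺yk)
            ; (tri≈ _ xk≡yk _) → contradiction xk≡yk xk≢yk
            ; (tri> _ _ yk≺xk) → contradiction (k , (λ i i<k → sym (agree i i<k)) , yk≺xk) x≲y }
    where
    agree : x ≈[ k ] y
    agree i i<k = decidable-stable (STO._≟_ 0 (x i) (y i)) (below i i<k)

  <∞⇒≲ : ∀ {x y} → x <∞ y → x ≲ y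
  <∞⇒≲ x<y y<x = <∞-irrefl (λ _ → refl) (<∞-trans x<y y<x)

  <∨≗⇒≲ : ∀ {x y} → x <∞ y ⊎ x ≗ y → x ≲ y
  <∨≗⇒≲ (inj₁ x<y) = <∞⇒≲ x<y
  <∨≗⇒≲ (inj₂ x≗y) = <∞-irrefl (≗-sym x≗y)

  ≲-refl : ∀ {x} → x ≲ x
  ≲-refl = <∞-irrefl (λ _ → refl)

  ≲-<-trans : ∀ {x y z} → x ≲ y → y <∞ z → x <∞ z
  ≲-<-trans x≲y y<z with ≲⇒<∨≗ x≲y
  ... | inj₁ x<y = <∞-trans x<y y<z
  ... | inj₂ x≗y = <∞-resp (≗-sym x≗y) (λ _ → refl) y<z

  ≲-<[]-trans : ∀ {x y z l} → x ≲ y → y <[ l ] z → ∃ λ m → m ≤ l × x <[ m ] z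
  ≲-<[]-trans x≲y y<z with ≲⇒<∨≗ x≲y
  ... | inj₁ (_ , x<y) = <[]-trans x<y y<z
  ... | inj₂ x≗y       = _ , ≤-refl , <[]-resp (≗-sym x≗y) (λ _ → refl) y<z

  <-≲-trans : ∀ {x y z} → x <∞ y → y ≲ z → x <∞ z
  <-≲-trans x<y y≲z with ≲⇒<∨≗ y≲z
  ... | inj₁ y<z = <∞-trans x<y y<z
  ... | inj₂ y≗z = <∞-resp (λ _ → refl) y≗z x<y

  ≲-trans : ∀ {x y z} → x ≲ y → y ≲ z → x ≲ z
  ≲-trans x≲y y≲z z<x = y≲z (<-≲-trans z<x x≲y)

  -- Comparing ux with x through u^ω.

  -- The longest common prefix of u·x and x has period |u|, so it is shared by
  -- u^ω, and the letter of u·x following it is again that of u^ω.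
  ·<⇒^∞< : ∀ {u x} → u ≢ [] → u ·∞ x <∞ x → u ^∞ <∞ x
  ·<⇒^∞< {u} {x} u≢[] (k , ux≈x , lt) = k , (λ i i<k → sym (x≈u i i<k)) ,
    subst (λ c → c ≺[ k ] x k) (^∞-next u≢[] x≈u k (n<1+n k)) lt
    where x≈u = ^∞-periodic {k = k} u≢[] (λ i i<k → sym (ux≈x i i<k))

  <·⇒<^∞ : ∀ {u x} → u ≢ [] → x <∞ u ·∞ x → x <∞ u ^∞
  <·⇒<^∞ {u} {x} u≢[] (k , x≈ux , lt) = k , x≈u ,
    subst (λ d → x k ≺[ k ] d) (^∞-next u≢[] x≈u k (n<1+n k)) lt
    where x≈u = ^∞-periodic {k = k} u≢[] x≈ux

  -- If x and u^ω share k letters, then ux and u^ω share k+1, so ux carries the letter of u^ω at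
  -- position k.
  ^∞<⇒·< : ∀ {u x} → u ≢ [] → u ^∞ <∞ x → u ·∞ x <∞ x
  ^∞<⇒·< {u} {x} u≢[] (k , u≈x , lt) = k ,
    (λ i i<k → trans (next i (m<n⇒m<1+n i<k)) (u≈x i i<k)) ,
    subst (λ c → c ≺[ k ] x k) (sym (next k (n<1+n k))) lt
    where next = ^∞-next {k = k} u≢[] (λ i i<k → sym (u≈x i i<k))

  <^∞⇒<· : ∀ {u x} → u ≢ [] → x <∞ u ^∞ → x <∞ u ·∞ x
  <^∞⇒<· {u} {x} u≢[] (k , x≈u , lt) = k ,
    (λ i i<k → trans (x≈u i i<k) (sym (next i (m<n⇒m<1+n i<k)))) ,
    subst (λ d → x k ≺[ k ] d) (sym (next k (n<1+n k))) lt
    where next = ^∞-next {k = k} u≢[] x≈u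

  -- Since uv·v^ω = u·v^ω, comparing (uv)^ω with v^ω and comparing u^ω with v^ω are the same
  -- comparison of u·v^ω with v^ω.
  ++-^∞<⇒^∞< : ∀ {u v} → u ≢ [] → (u ++ v) ^∞ <∞ v ^∞ → u ^∞ <∞ v ^∞
  ++-^∞<⇒^∞< {u} {v} u≢[] uv<v = ·<⇒^∞< u≢[] (<∞-resp
    (≗-trans (·∞-++ u v _) (·∞-cong u (≗-sym (^∞-unfold v)))) (λ _ → refl)
    (^∞<⇒·< (++-≢[]ˡ v u≢[]) uv<v))

  ^∞<⇒++-^∞< : ∀ {u v} → u ≢ [] → u ^∞ <∞ v ^∞ → (u ++ v) ^∞ <∞ v ^∞
  ^∞<⇒++-^∞< {u} {v} u≢[] u<v = ·<⇒^∞< (++-≢[]ˡ v u≢[]) (<∞-resp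
    (≗-trans (·∞-cong u (^∞-unfold v)) (≗-sym (·∞-++ u v _))) (λ _ → refl)
    (^∞<⇒·< u≢[] u<v))

  -- The generalized lexicographic order through first differences.

  differ-<[] : ∀ {p c d} {x y : ℕ → A} → c ≺[ length p ] d →
               (p ∷ʳ c) ·∞ x <[ length p ] (p ∷ʳ d) ·∞ y
  differ-<[] {p} {c} {d} {x} {y} c≺d = <[]-resp
    (≗-sym (·∞-++ p [ c ] x)) (≗-sym (·∞-++ p [ d ] y))
    (·∞-agree p _ _ , subst₂ (λ c d → c ≺[ length p ] d)
      (sym (at p ([ c ] ·∞ x))) (sym (at p ([ d ] ·∞ y))) c≺d)
    where
    at : ∀ p (x : ℕ → A) → (p ·∞ x) (length p) ≡ x 0
    at []      x = refl
    at (_ ∷ p) x = at p x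

  inf-<⁻ : ∀ {x y} → inf x < inf y → x <∞ y
  inf-<⁻ (proper-prefix _ _ _ () _)
  inf-<⁻ (differ p c d (inf s) (inf t) c≺d (inf x≗) (inf y≗)) =
    _ , <[]-resp (≗-sym x≗) (≗-sym y≗) (differ-<[] {p} c≺d)

  inf-<⁺ : ∀ {x y} → x <∞ y → inf x < inf y
  inf-<⁺ {x} {y} (k , x≈y , lt) = differ (applyUpTo x k) (x k) (y k)
    (inf (x [ suc k ,∞⟩)) (inf (y [ suc k ,∞⟩))
    (subst (λ n → x k ≺[ n ] y k) (sym (length-applyUpTo x k)) lt)
    (inf (λ i → trans (applyUpTo-·∞ x (suc k) i)
      (cong (λ u → (u ·∞ _) i) (sym (applyUpTo-∷ʳ x k)))))
    (inf (λ i → trans (applyUpTo-·∞ y (suc k) i)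
      (cong (λ u → (u ·∞ _) i) (trans (sym (applyUpTo-∷ʳ y k))
        (cong (_∷ʳ y k) (sym (applyUpTo-cong k x≈y)))))))

  -- Equal lengths exclude a proper prefix, so the difference lies inside u and v and survives any
  -- continuations.
  fin-<⁻ : ∀ {u v} x y → length u ≡ length v → fin u < fin v → u ·∞ x <∞ v ·∞ y
  fin-<⁻ x y eq (proper-prefix p c (fin s) (fin refl) (fin refl)) =
    contradiction (trans eq (trans (length-++ (p ∷ʳ c)) (cong (_+ length s)
      (trans (length-++ p) (+-comm (length p) 1))))) (<⇒≢ (s≤s (m≤m+n _ _)))
  fin-<⁻ x y eq (differ p c d (fin s) (fin t) c≺d (fin refl) (fin refl)) =
    _ , <[]-resp (≗-sym (·∞-++ (p ∷ʳ c) s x)) (≗-sym (·∞-++ (p ∷ʳ d) t y)) (differ-<[] {p} c≺d)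

  fin-<⁺ : ∀ {u v} x y {k} → length u ≡ length v → k <ℕ length u →
           u ·∞ x <[ k ] v ·∞ y → fin u < fin v
  fin-<⁺ {u} {v} x y {k} eq k<u (ux≈vy , lt) = differ (applyUpTo (u ·∞ x) k) _ _
    (fin (drop (suc k) u)) (fin (drop (suc k) v))
    (subst (λ n → (u ·∞ x) k ≺[ n ] (v ·∞ y) k) (sym (length-applyUpTo (u ·∞ x) k)) lt)
    (fin (decompose u x k<u refl))
    (fin (decompose v y (subst (k <ℕ_) eq k<u) (applyUpTo-cong k ux≈vy)))
    where
    decompose : ∀ u x {p} → k <ℕ length u → p ≡ applyUpTo (u ·∞ x) k →
                u ≡ (p ∷ʳ (u ·∞ x) k) ++ drop (suc k) u
    decompose u x k<u refl = trans (sym (take++drop≡id (suc k) u))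
      (cong (_++ drop (suc k) u) (trans (take-applyUpTo u x k<u) (sym (applyUpTo-∷ʳ (u ·∞ x) k))))

  -- Lyndon words in terms of ω-powers and suffixes.

  -- From uv < vu follows (uv)^ω < (vu)^ω = v(uv)^ω, and comparing a word with v prepended to it is
  -- comparing it with v^ω.
  Lyndon-fin⁻ : ∀ {u v} → u ≢ [] → v ≢ [] → Lyndon (fin (u ++ v)) → (u ++ v) ^∞ <∞ v ^∞
  Lyndon-fin⁻ {u} {v} u≢[] v≢[] (_ , uv<vu) = <·⇒<^∞ v≢[] (<∞-resp
    (≗-sym (^∞-unfold (u ++ v)))
    (≗-trans (≗-sym (^∞-unfold (v ++ u))) (≗-sym (^∞-rotate {v} (++-≢[]ʳ u v≢[]))))
    (fin-<⁻ _ _ (length-++-comm u v) (uv<vu u v u≢[] v≢[] refl)))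

  Lyndon-fin⁺ : ∀ {w} → w ≢ [] →
    (∀ u v → u ≢ [] → v ≢ [] → w ≡ u ++ v → w ^∞ <∞ v ^∞) → Lyndon (fin w)
  Lyndon-fin⁺ w≢[] suffixes = w≢[] , λ where
      u v u≢[] v≢[] refl → smaller u v v≢[] (suffixes u v u≢[] v≢[] refl)
    where
    smaller : ∀ u v → v ≢ [] → (u ++ v) ^∞ <∞ v ^∞ → fin (u ++ v) < fin (v ++ u)
    smaller u v v≢[] uv<v with <∞-resp (^∞-unfold (u ++ v))
      (≗-trans (^∞-rotate {v} (++-≢[]ʳ u v≢[])) (^∞-unfold (v ++ u))) (<^∞⇒<· v≢[] uv<v)
    -- A first difference at position |uv| or later would force uv = vu, and then the two words
    -- compared would coincide.
    ... | k , lt@(agree , _) = fin-<⁺ _ _ len (≰⇒> λ uv≤k → <∞-irrefl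
            (subst (λ w → (u ++ v) ·∞ (u ++ v) ^∞ ≗ w ·∞ w ^∞) (equal uv≤k) (λ _ → refl)) (k , lt)) lt
      where
      len = length-++-comm u v
      equal : length (u ++ v) ≤ k → u ++ v ≡ v ++ u
      equal uv≤k = trans (sym (applyUpTo-length (u ++ v) _))
        (trans (applyUpTo-cong _ λ i i<n → agree i (<-≤-trans i<n uv≤k))
        (trans (cong (applyUpTo _) len) (applyUpTo-length (v ++ u) _)))

  Lyndon-inf⁻ : ∀ {x u y} → u ≢ [] → x ≗ u ·∞ y → Lyndon (inf x) → x <∞ y
  Lyndon-inf⁻ {u = u} {y} u≢[] x≗uy L = inf-<⁻ (L u y u≢[] (inf x≗uy))

  Lyndon-inf⁺ : ∀ {x} → (∀ u y → u ≢ [] → x ≗ u ·∞ y → x <∞ y) → Lyndon (inf x)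
  Lyndon-inf⁺ suffixes u y u≢[] (inf x≗uy) = inf-<⁺ (suffixes u y u≢[] x≗uy)

  Lyndon-resp : ∀ {x y} → x ≗ y → Lyndon (inf x) → Lyndon (inf y)
  Lyndon-resp x≗y L = Lyndon-inf⁺ λ u z u≢[] y≗uz →
    <∞-resp x≗y (λ _ → refl) (Lyndon-inf⁻ u≢[] (≗-trans x≗y y≗uz) L)

  -- Suffixes of nonincreasing Lyndon products, and uniqueness.

  -- Nonincreasing Lyndon factors whose last one, if any, has ω-power ≥ b.
  data Chain : List (List A) → (ℕ → A) → Set (a ⊔ r) where
    []    : ∀ {b} → Chain [] b
    chain : ∀ {us u b} → Chain us (u ^∞) → Lyndon (fin u) → b ≲ u ^∞ → Chain (us ∷ʳ u) b

  -- A suffix inside the last factor u has ω-power at least u^ω because u is Lyndon. Any other is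
  -- s′u with s′ a suffix of the earlier product, where s′^ω ≥ u^ω by induction, hence (s′u)^ω ≥
  -- u^ω.
  suffix-≳ : ∀ {us b} → Chain us b → ∀ c s → s ≢ [] → concat us ≡ c ++ s → b ≲ s ^∞
  suffix-≳ [] c s s≢[] eq = contradiction (++-conicalʳ c s (sym eq)) s≢[]
  suffix-≳ (chain {us} {u} ch Lu b≲u) c s s≢[] eq
    with ++-align (concat us) u c s (trans (sym (concat-∷ʳ us u)) eq)
  ... | inj₁ ([] , _ , refl)           = b≲u
  ... | inj₁ (s′@(_ ∷ _) , eq′ , refl) = ≲-trans b≲u
        (suffix-≳ ch c s′ (λ ()) eq′ ∘ ++-^∞<⇒^∞< {s′} (λ ()))
  ... | inj₂ ([] , _ , refl)           = b≲u
  ... | inj₂ (t@(_ ∷ _) , _ , refl)    = ≲-trans b≲u (<∞⇒≲ (Lyndon-fin⁻ {t} (λ ()) s≢[] Lu))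

  -- For nonempty t, (tu)^ω < u^ω gives t^ω < u^ω, against `suffix-≳` for the product preceding u.
  last-unique : ∀ {us u c t} → Chain us (u ^∞) → Lyndon (fin u) → Lyndon (fin (t ++ u)) →
                concat us ≡ c ++ t → t ≡ []
  last-unique {t = []}        ch Lu Ltu eq = refl
  last-unique {c = c} {t = t@(_ ∷ _)} ch Lu Ltu eq = contradiction
    (++-^∞<⇒^∞< {t} (λ ()) (Lyndon-fin⁻ {t} (λ ()) (proj₁ Lu) Ltu))
    (suffix-≳ ch c t (λ ()) eq)

  -- Of the two last factors one is a suffix of the other, so `last-unique` identifies them; the
  -- rest follows by induction.
  Chain-unique : ∀ {us vs b c} → Chain us b → Chain vs c → concat us ≡ concat vs → us ≡ vs
  Chain-unique [] [] eq = refl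
  Chain-unique [] (chain {vs} {v} _ Lv _) eq =
    contradiction (++-conicalʳ _ v (sym (trans eq (concat-∷ʳ vs v)))) (proj₁ Lv)
  Chain-unique (chain {us} {u} _ Lu _) [] eq =
    contradiction (++-conicalʳ _ u (trans (sym (concat-∷ʳ us u)) eq)) (proj₁ Lu)
  Chain-unique (chain {us} {u} chᵤ Lu _) (chain {vs} {v} chᵥ Lv _) eq
    with ++-align (concat us) u (concat vs) v
           (trans (sym (concat-∷ʳ us u)) (trans eq (concat-∷ʳ vs v)))
  ... | inj₁ (t , eq′ , refl) with last-unique {t = t} chᵤ Lu Lv eq′
  ...   | refl = cong (_∷ʳ u) (Chain-unique chᵤ chᵥ (trans eq′ (++-identityʳ _)))
  Chain-unique (chain {us} {u} chᵤ Lu _) (chain {vs} {v} chᵥ Lv _) eq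
      | inj₂ (t , eq′ , refl) with last-unique {t = t} chᵥ Lv Lu eq′
  ...   | refl = cong (_∷ʳ v) (Chain-unique chᵤ chᵥ (sym (trans eq′ (++-identityʳ _))))

  -- Existence for finite words.

  suffix-∷ : ∀ {d : A} {w} c s → d ∷ w ≡ c ++ s → s ≡ d ∷ w ⊎ ∃ λ c′ → w ≡ c′ ++ s
  suffix-∷ []      s eq = inj₁ (sym eq)
  suffix-∷ (_ ∷ c) s eq = inj₂ (c , ∷-injectiveʳ eq)

  suffix-∷-proper : ∀ {d : A} {w} c s → c ≢ [] → d ∷ w ≡ c ++ s → ∃ λ c′ → w ≡ c′ ++ s
  suffix-∷-proper []      s c≢[] eq = contradiction refl c≢[]
  suffix-∷-proper (_ ∷ c) s c≢[] eq = c , ∷-injectiveʳ eq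

  -- Extending leftwards, the minimum is replaced only by a strictly smaller word. Such a word is
  -- strictly below all its proper suffixes, hence Lyndon; ties keep the shorter suffix.
  min-suffix : ∀ d w → ∃₂ λ c s → d ∷ w ≡ c ++ s × Lyndon (fin s) ×
    (∀ c′ s′ → s′ ≢ [] → d ∷ w ≡ c′ ++ s′ → s ^∞ ≲ s′ ^∞)
  min-suffix d [] = [] , [ d ] , refl ,
    Lyndon-fin⁺ (λ ()) (λ u v u≢[] v≢[] eq → case suffix-∷-proper u v u≢[] eq of λ
      { (c , eq′) → contradiction (++-conicalʳ c v (sym eq′)) v≢[] }) ,
    λ c s s≢[] eq → case suffix-∷ c s eq of λ
      { (inj₁ refl) → ≲-refl
      ; (inj₂ (c′ , eq′)) → contradiction (++-conicalʳ c′ s (sym eq′)) s≢[] }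
  min-suffix d w@(e ∷ w′) with min-suffix e w′
  ... | c , s , eq , Ls , s-min with em {(d ∷ w) ^∞ <∞ s ^∞}
  ...   | yes dw<s = [] , d ∷ w , refl ,
          Lyndon-fin⁺ (λ ()) (λ u v u≢[] v≢[] eq → case suffix-∷-proper u v u≢[] eq of λ
            { (c , eq′) → <-≲-trans dw<s (s-min c v v≢[] eq′) }) ,
          λ c s s≢[] eq → case suffix-∷ c s eq of λ
            { (inj₁ refl) → ≲-refl
            ; (inj₂ (c′ , eq′)) → ≲-trans (<∞⇒≲ dw<s) (s-min c′ s s≢[] eq′) }
  ...   | no s≲dw = d ∷ c , s , cong (d ∷_) eq , Ls ,
          λ c s s≢[] eq → case suffix-∷ c s eq of λ
            { (inj₁ refl) → s≲dw
            ; (inj₂ (c′ , eq′)) → s-min c′ s s≢[] eq′ }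

  Chain-exists : ∀ n w {b} → length w ≤ n →
    (∀ c s → s ≢ [] → w ≡ c ++ s → b ≲ s ^∞) → ∃ λ us → Chain us b × concat us ≡ w
  Chain-exists n       []      w≤n _ = [] , [] , refl
  Chain-exists (suc n) (d ∷ w) w≤n b≲ with min-suffix d w
  ... | c , s , eq , Ls , s-min with Chain-exists n c shorter c-bound
    where
    shorter : length c ≤ n
    shorter = ≤-pred (≤-trans (m<m+n (length c) (0<length (proj₁ Ls)))
      (≤-trans (≤-reflexive (sym (trans (cong length eq) (length-++ c)))) w≤n))
    -- Were s′^ω < s^ω, then (s′s)^ω < s^ω too, against minimality of s.
    c-bound : ∀ c′ s′ → s′ ≢ [] → c ≡ c′ ++ s′ → s ^∞ ≲ s′ ^∞
    c-bound c′ s′ s′≢[] refl s′<s =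
      s-min c′ (s′ ++ s) (++-≢[]ˡ s s′≢[]) (trans eq (++-assoc c′ s′ s)) (^∞<⇒++-^∞< s′≢[] s′<s)
  ...   | us , ch , refl = us ∷ʳ s , chain ch Ls (b≲ c s (proj₁ Ls) eq) ,
          trans (concat-∷ʳ us s) (sym eq)

  -- Prefixes before the first infinite Lyndon suffix.

  -- Induction on p. If px < x while tx ≥ x for all proper suffixes t of p, then px is below each
  -- such tx, below x, and below every suffix of the Lyndon word x. So px would be Lyndon, which is
  -- excluded.
  ≲-preceding : ∀ {x} → Lyndon (inf x) → ∀ p →
    (∀ c u → u ≢ [] → p ≡ c ++ u → ¬ Lyndon (inf (u ·∞ x))) →
    ∀ c u → p ≡ c ++ u → x ≲ u ·∞ x
  ≲-preceding Lx [] _ c u eq with ++-conicalʳ c u (sym eq)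
  ... | refl = ≲-refl
  ≲-preceding {x} Lx (d ∷ p) none c u eq with suffix-∷ c u eq
  ... | inj₂ (c′ , eq′) =
        ≲-preceding Lx p (λ c u u≢[] eq → none (d ∷ c) u u≢[] (cong (d ∷_) eq)) c′ u eq′
  ... | inj₁ refl = λ ux<x → none [] u (λ ()) refl (Lyndon-inf⁺ (smaller ux<x))
    where
    smaller : u ·∞ x <∞ x → ∀ v y → v ≢ [] → u ·∞ x ≗ v ·∞ y → u ·∞ x <∞ y
    smaller ux<x v y v≢[] eq with ·∞-align u v eq
    ... | inj₁ (t , eq′ , y≗tx) with suffix-∷-proper v t v≢[] eq′
    ...   | c′ , eq″ = <-≲-trans ux<x (≲-resp (λ _ → refl) (≗-sym y≗tx)
            (≲-preceding Lx p (λ c u u≢[] eq → none (d ∷ c) u u≢[] (cong (d ∷_) eq)) c′ t eq″))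
    smaller ux<x v y v≢[] eq | inj₂ ([] , _ , x≗y) = <∞-resp (λ _ → refl) x≗y ux<x
    smaller ux<x v y v≢[] eq | inj₂ (t@(_ ∷ _) , _ , x≗ty) =
      <∞-trans ux<x (Lyndon-inf⁻ {u = t} (λ ()) x≗ty Lx)

  -- Chains and factorizations.

  ≥⇒≲ : ∀ {x y} → inf x ≥ inf y → y ≲ x
  ≥⇒≲ (inj₁ y<x)       = <∞⇒≲ (inf-<⁻ y<x)
  ≥⇒≲ (inj₂ (inf y≗x)) = <∨≗⇒≲ (inj₂ y≗x)

  ≲⇒≥ : ∀ {x y} → y ≲ x → inf x ≥ inf y
  ≲⇒≥ y≲x with ≲⇒<∨≗ y≲x
  ... | inj₁ y<x = inj₁ (inf-<⁺ y<x)
  ... | inj₂ y≗x = inj₂ (inf y≗x)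

  _≥ω_ : Word A → Word A → Set (a ⊔ r)
  u ≥ω v = u ^ω ≥ v ^ω

  -- `Chain` grows on the right and `Linked` on the left, hence the reverse view. The next factor z
  -- is infinite at the outset and finite in the recursion.
  Chain⁻ : ∀ {us z b} → Reverse us → z ^ω ≡ inf b → All Lyndon (map fin us) →
           Linked _≥ω_ (map fin us ∷ʳ z) → Chain us b
  Chain⁻ [] _ _ _ = []
  Chain⁻ {z = z} (us ∶ rs ∶ʳ u) z^ω Ls links
    with ∷ʳ⁻ (subst (All Lyndon) (map-++ fin us [ u ]) Ls)
       | Linked-∷ʳ⁻ (map fin us) (subst (λ ws → Linked _≥ω_ (ws ∷ʳ z)) (map-++ fin us [ u ]) links)
  ... | Lus , Lu | links′ , u≥z =
        chain (Chain⁻ rs (fin-^ω (proj₁ Lu)) Lus links′) Lu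
          (≥⇒≲ (subst₂ _≥_ (fin-^ω (proj₁ Lu)) z^ω u≥z))

  Chain⁺ : ∀ {us z b} → Chain us b → z ^ω ≡ inf b →
           All Lyndon (map fin us) × Linked _≥ω_ (map fin us ∷ʳ z)
  Chain⁺ [] z^ω = [] , [-]
  Chain⁺ {z = z} (chain {us} {u} ch Lu b≲u) z^ω with Chain⁺ ch (fin-^ω (proj₁ Lu))
  ... | Ls , links =
        subst (All Lyndon) (sym (map-++ fin us [ u ])) (∷ʳ⁺ Ls Lu) ,
        subst (λ ws → Linked _≥ω_ (ws ∷ʳ z)) (sym (map-++ fin us [ u ]))
          (Linked-∷ʳ⁺ (map fin us) links
            (subst₂ _≥_ (sym (fin-^ω (proj₁ Lu))) (sym z^ω) (≲⇒≥ b≲u)))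

  -- An earlier Lyndon suffix would be sy with s a nonempty suffix of the product; sy < y gives s^ω
  -- < y, against `suffix-≳`.
  Chain⇒first : ∀ {w us y} → Chain us y → Lyndon (inf y) → w ≗ concat us ·∞ y →
                IsFirstLyndonSuffixIndex w (length (concat us))
  Chain⇒first {w} {us} {y} ch Ly w≗ =
    Lyndon-resp (≗-sym (suffix-at (concat us) w≗)) Ly , λ i Li → ≮⇒≥ (minimal i Li)
    where
    minimal : ∀ i → Lyndon (inf (w [ i ,∞⟩)) → ¬ i <ℕ length (concat us)
    minimal i Li i<n with split-at< (concat us) i<n
    ... | c , s , eq , refl , s≢[] = suffix-≳ ch c s s≢[] eq (·<⇒^∞< s≢[]
          (<∞-resp wᵢ≗ (λ _ → refl) (Lyndon-inf⁻ s≢[] wᵢ≗ Li)))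
      where
      wᵢ≗ : w [ i ,∞⟩ ≗ s ·∞ y
      wᵢ≗ = suffix-of-prefix c s (subst (λ u → w ≗ u ·∞ y) eq w≗)

  -- Infinite products have no Lyndon suffix.

  module _ {w f} (product : inf w IsProductOf infinitely f)
           (Lf : ∀ i → Lyndon (fin (f i))) (f≥ : ∀ i → fin (f i) ≥ω fin (f (suc i))) where

    private
      C : ℕ → List A
      C n = concat (applyUpTo f n)

      -- With factors ℓ₁ℓ₂ ... numbered from 1, `f n` is ℓₙ₊₁ and `Y n` is the rest yₙ.
      Y : ℕ → ℕ → A
      Y n = w [ length (C n) ,∞⟩

    C-suc : ∀ n → C (suc n) ≡ C n ++ f n
    C-suc n = trans (cong concat (sym (applyUpTo-∷ʳ f n))) (concat-∷ʳ (applyUpTo f n) (f n))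

    -- A partial product is a prefix of itself, so the description of w by finite prefixes makes it
    -- a prefix of w.
    w≗CY : ∀ n → w ≗ C n ·∞ Y n
    w≗CY n with Equivalence.from (product (C n)) (n , fin [] , fin (sym (++-identityʳ (C n))))
    ... | inf s , inf w≗Cs = ≗-trans w≗Cs (·∞-cong (C n) (≗-sym (suffix-at (C n) w≗Cs)))

    Y≗fY : ∀ n → Y n ≗ f n ·∞ Y (suc n)
    Y≗fY n = suffix-of-prefix (C n) (f n) (subst (λ u → w ≗ u ·∞ Y (suc n)) (C-suc n) (w≗CY (suc n)))

    n≤length-C : ∀ n → n ≤ length (C n)
    n≤length-C zero    = z≤n
    n≤length-C (suc n) = ≤-trans
      (≤-trans (≤-reflexive (+-comm 1 n)) (+-mono-≤ (n≤length-C n) (0<length (proj₁ (Lf n)))))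
      (≤-reflexive (sym (trans (cong length (C-suc n)) (length-++ (C n)))))

    f-≲ : ∀ n → f (suc n) ^∞ ≲ f n ^∞
    f-≲ n = ≥⇒≲ (subst₂ _≥_ (fin-^ω (proj₁ (Lf n))) (fin-^ω (proj₁ (Lf (suc n)))) (f≥ n))

    Chain-suc : ∀ {b} n → Chain (applyUpTo f n) (f n ^∞) → b ≲ f n ^∞ → Chain (applyUpTo f (suc n)) b
    Chain-suc n ch b≲ = subst (λ us → Chain us _) (applyUpTo-∷ʳ f n) (chain ch (Lf n) b≲)

    Chain-applyUpTo : ∀ n → Chain (applyUpTo f n) (f n ^∞)
    Chain-applyUpTo zero    = []
    Chain-applyUpTo (suc n) = Chain-suc n (Chain-applyUpTo n) (f-≲ n)

    -- Factors are nonempty, so index j lies inside `C (suc n)` and the suffix there is s followed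
    -- by `Y (suc n)` with s nonempty. Being Lyndon it is below `Y (suc n)`, hence so is s^ω, which
    -- is at least the ω-power of `f n`.
    factor<rest : ∀ {j} → Lyndon (inf (w [ j ,∞⟩)) → ∀ n → j ≤ n → f n ^∞ <∞ Y (suc n)
    factor<rest {j} Lj n j≤n with split-at< (C (suc n)) (≤-trans (s≤s j≤n) (n≤length-C (suc n)))
    ... | c , s , eq , refl , s≢[] = ≲-<-trans
          (suffix-≳ (Chain-suc n (Chain-applyUpTo n) ≲-refl) c s s≢[] eq)
          (·<⇒^∞< s≢[] (<∞-resp wⱼ≗ (λ _ → refl) (Lyndon-inf⁻ s≢[] wⱼ≗ Lj)))
      where
      wⱼ≗ : w [ j ,∞⟩ ≗ s ·∞ Y (suc n)
      wⱼ≗ = suffix-of-prefix c s (subst (λ u → w ≗ u ·∞ Y (suc n)) eq (w≗CY (suc n)))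

    -- f (n+1)^ω ≤ f n^ω falls below Y (n+1) at position g or earlier; both words
    -- begin with f (n+1), and what follows differs at a smaller position.
    infinite-descent : ∀ {j} → Lyndon (inf (w [ j ,∞⟩)) → ∀ g n → j ≤ n → ¬ f n ^∞ <[ g ] Y (suc n)
    infinite-descent {j} Lj = <-rec _ step
      where
      step : ∀ g → (∀ {h} → h <ℕ g → ∀ n → j ≤ n → ¬ f n ^∞ <[ h ] Y (suc n)) →
             ∀ n → j ≤ n → ¬ f n ^∞ <[ g ] Y (suc n)
      step g rec n j≤n fₙ<Y
        with ≲-<[]-trans (f-≲ n) fₙ<Y | factor<rest Lj (suc n) (m≤n⇒m≤1+n j≤n)
      ... | m , m≤g , fₙ₊₁<Y | h , fₙ₊₁<Y′@(agree , _) =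
            rec (<-≤-trans (<-≤-trans (m<n+m h (0<length (proj₁ (Lf (suc n))))) (≮⇒≥ m≮)) m≤g)
                (suc n) (m≤n⇒m≤1+n j≤n) fₙ₊₁<Y′
        where
        fₙ₊₁·<Y : f (suc n) ·∞ f (suc n) ^∞ <[ m ] f (suc n) ·∞ Y (suc (suc n))
        fₙ₊₁·<Y = <[]-resp (^∞-unfold (f (suc n))) (Y≗fY (suc n)) fₙ₊₁<Y
        m≮ : ¬ m <ℕ length (f (suc n)) + h
        m≮ m< = ≺-irrefl (·∞-agree-+ (f (suc n)) agree m m<) (proj₂ fₙ₊₁·<Y)

    no-Lyndon-suffix : ∀ j → ¬ Lyndon (inf (w [ j ,∞⟩))
    no-Lyndon-suffix j Lj with factor<rest Lj j ≤-refl
    ... | g , fⱼ<Y = infinite-descent Lj g j ≤-refl fⱼ<Y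

  -- Existence and uniqueness for infinite words.

  factorization-exists : ∀ w j → IsFirstLyndonSuffixIndex w j →
    ∃ λ us → IsNonincreasingLyndonFactorization (inf w) (finitely us (inf (w [ j ,∞⟩)))
  factorization-exists w j (Lj , j-min)
    with Chain-exists (length (applyUpTo w j)) (applyUpTo w j) {w [ j ,∞⟩} ≤-refl
      (λ c s s≢[] eq s<wⱼ → ≲-preceding Lj (applyUpTo w j) none c s eq (^∞<⇒·< s≢[] s<wⱼ))
    where
    -- Such a Lyndon word would be the suffix of w at index |c| < j.
    none : ∀ c u → u ≢ [] → applyUpTo w j ≡ c ++ u → ¬ Lyndon (inf (u ·∞ w [ j ,∞⟩))
    none c u u≢[] eq Lu = <⇒≱ (m<m+n (length c) (0<length u≢[])) (≤-trans
      (≤-reflexive (trans (sym (length-++ c)) (trans (cong length (sym eq)) (length-applyUpTo w j))))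
      (j-min (length c) (Lyndon-resp (≗-sym (suffix-of-prefix c u
        (subst (λ p → w ≗ p ·∞ w [ j ,∞⟩) eq (applyUpTo-·∞ w j)))) Lu)))
  ... | us , ch , eq with Chain⁺ ch refl
  ...   | Ls , links = us ,
          inf (subst (λ p → w ≗ p ·∞ w [ j ,∞⟩) (sym eq) (applyUpTo-·∞ w j)) , ∷ʳ⁺ Ls Lj , links

  -- A finite product equal to an infinite word ends in an infinite factor; `no-Lyndon-suffix`
  -- excludes infinitely many factors.
  factorization⇒Chain : ∀ {w j} → Lyndon (inf (w [ j ,∞⟩)) → ∀ F →
    IsNonincreasingLyndonFactorization (inf w) F →
    ∃₂ λ us y → F ≡ finitely us (inf y) × Chain us y × Lyndon (inf y) × w ≗ concat us ·∞ y
  factorization⇒Chain Lj (finitely us (inf y)) (inf w≗ , Ls , links) with ∷ʳ⁻ Ls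
  ... | Lus , Ly = us , y , refl , Chain⁻ (reverseView us) refl Lus links , Ly , w≗
  factorization⇒Chain Lj (infinitely f) (product , Lf , f≥) =
    ⊥-elim (no-Lyndon-suffix product Lf f≥ _ Lj)

  first-unique : ∀ w {i j} → IsFirstLyndonSuffixIndex w i → IsFirstLyndonSuffixIndex w j → i ≡ j
  first-unique w (Li , i-min) (Lj , j-min) = ≤-antisym (i-min _ Lj) (j-min _ Li)

  -- Both last factors start at the first Lyndon suffix index, so the preceding products have equal
  -- length and coincide; `Chain-unique` finishes.
  factorization-unique : ∀ {w j} → Lyndon (inf (w [ j ,∞⟩)) → ∀ {F G} →
    IsNonincreasingLyndonFactorization (inf w) F →
    IsNonincreasingLyndonFactorization (inf w) G → F ≈ᶠ G
  factorization-unique {w} Lj {F} {G} facF facG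
    with factorization⇒Chain Lj F facF | factorization⇒Chain Lj G facG
  ... | us , x , refl , chᵤ , Lx , w≗ux | vs , y , refl , chᵥ , Ly , w≗vy = finitely
        (Chain-unique chᵤ chᵥ (prefix-unique (concat us) (concat vs) w≗ux w≗vy len))
        (inf (≗-trans (≗-sym (suffix-at (concat us) w≗ux))
          (subst (λ n → w [ n ,∞⟩ ≗ y) (sym len) (suffix-at (concat vs) w≗vy))))
    where
    len : length (concat us) ≡ length (concat vs)
    len = first-unique w (Chain⇒first chᵤ Lx w≗ux) (Chain⇒first chᵥ Ly w≗vy)

theorem3 : ∀ {a r} → ExcludedMiddle (a ⊔ r) →
    (A : Set a) (_≺[_]_ : A → ℕ → A → Set r) →
    (∀ n → IsStrictTotalOrder _≡_ (λ c d → c ≺[ n ] d)) →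
    let open GeneralizedLexicographic _≺[_]_ in
    (w : ℕ → A) → (∃ λ j → Lyndon (inf (w [ j ,∞⟩))) →
    ∃! _≈ᶠ_ (IsNonincreasingLyndonFactorization (inf w)) ×
    (∀ F → IsNonincreasingLyndonFactorization (inf w) F →
    ∃₂ λ us x → F ≡ finitely us x ×
    (∃ λ j → IsFirstLyndonSuffixIndex w j × x ≈ inf (w [ j ,∞⟩)))
theorem3 {a} {r} em A _≺[_]_ isSTO w (j , Lj)
  with least (λ i → em {GeneralizedLexicographic.Lyndon _≺[_]_ (inf (w [ i ,∞⟩))}) (j , Lj)
-- The letter `w 0` serves as the default value of `_^∞` at the empty word.
... | i , Li , below with factorization-exists em _≺[_]_ isSTO (w 0) w i
                            (Li , λ k Lk → ≮⇒≥ λ k<i → below k k<i Lk)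
...   | us , fac = (_ , fac , factorization-unique em _≺[_]_ isSTO (w 0) Li fac) , λ F facF →
        case factorization⇒Chain em _≺[_]_ isSTO (w 0) Li F facF of λ
          { (vs , y , eq , ch , Ly , w≗) → vs , inf y , eq , length (concat vs) ,
              Chain⇒first em _≺[_]_ isSTO (w 0) ch Ly w≗ ,
              inf (≗-sym (suffix-at (concat vs) w≗)) }
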